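{- The class $\mathbb{K}_{\mathbf{mbC}}$ of all swap structures for $\mathbf{mbC}$ is closed under submultialgebras and (direct) products, but it is not closed under homomorphic images (closure being understood up to isomorphism of multialgebras).
   Context: Let $\Sigma=\{\wedge,\vee,\to,\neg,\circ\}$, with $\wedge,\vee,\to$ binary and $\neg,\circ$ unary. A multialgebra over $\Sigma$ is a nonempty set $B$ with, for each $n$-ary symbol $c$, a function $c^{\mathcal{B}}:B^n\to\wp(B)\setminus\{\emptyset\}$; $|\mathcal{B}|=B$. $\mathcal{B}$ is a submultialgebra of $\mathcal{A}$ if $|\mathcal{B}|\subseteq|\mathcal{A}|$ and $c^{\mathcal{B}}(\vec a)\subseteq c^{\mathcal{A}}(\vec a)$ for all $c$ and all $\vec a$ in $|\mathcal{B}|$. A homomorphism $f:\mathcal{A}\to\mathcal{B}$ is a function between the domains with $f[c^{\mathcal{A}}(\vec a)]\subseteq c^{\mathcal{B}}(f(\vec a))$ for all $c,\vec a$; an isomorphism is a bijective $f$ with equality here. The product $\prod_{i\in I}\mathcal{A}_i$ has as domain the cartesian product of the domains and multioperations $c(\vec a)=\prod_{i\in I}c^{\mathcal{A}_i}(\pi_i(\vec a))$ (the one-element multialgebra if $I=\emptyset$). The homomorphic (direct) image of a homomorphism $f:\mathcal{A}\to\mathcal{B}$ is the multialgebra $f(\mathcal{A})$ with domain $f[|\mathcal{A}|]$ and $c^{f(\mathcal{A})}(\vec b)=\bigcup\{f[c^{\mathcal{A}}(\vec a)] : f(\vec a)=\vec b\}$. For a Boolean algebra $\mathcal{A}$ with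 domain $A$ (the one-element Boolean algebra is allowed) and $z\in A^3$ write $z=(z_1,z_2,z_3)$. A swap structure for $\mathbf{mbC}$ over $\mathcal{A}$ is a multialgebra $\mathcal{B}$ over $\Sigma$ with domain $B\subseteq \{z\in A^3 : z_1\vee z_2=1 \text{ and } z_1\wedge z_2\wedge z_3=0\}$ such that $0\in\{z_1: z\in B\}$ and for all $z,w\in B$: (i) $\emptyset\ne z\#w\subseteq\{u\in B: u_1=z_1\# w_1\}$ for $\#\in\{\wedge,\vee,\to\}$; (ii) $\emptyset\neq\neg z\subseteq\{u\in B:u_1=z_2\}$; (iii) $\emptyset\ne\circ z\subseteq\{u\in B:u_1=z_3\}$. $\mathbb{K}_{\mathbf{mbC}}$ is the class of all swap structures for $\mathbf{mbC}$ over arbitrary Boolean algebras. -}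

module Defs where

open import Level using (Level; suc)
open import Algebra.Lattice.Bundles using (BooleanAlgebra)
open import Data.Fin.Patterns using (0F; 1F)
open import Data.Nat using (ℕ)
open import Data.Product using (Σ; ∃; ∃-syntax; _×_; _,_; proj₁; proj₂)
open import Data.Product.Relation.Binary.Pointwise.NonDependent using (×-setoid)
open import Data.Vec.Functional using (Vector)
open import Data.Vec.Functional.Relation.Binary.Pointwise using (Pointwise)
open import Function using (_∘_; Func; Bijective)
open import Relation.Binary using (Setoid; _Respects_)
import Relation.Binary.Construct.On as On
open import Relation.Unary using (Pred; _∈_; _⊆_; _≐_; Satisfiable)

private variable
  ℓ : Level
  n : ℕ

-- The signature Σ = {∧, ∨, →, ¬, ∘}, graded by arity.
data Symbol : ℕ → Set where
  and or imp : Symbol 2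
  neg circ   : Symbol 1

-- Sets are setoids and subsets are predicates respecting the setoid equality.
-- All data of a multialgebra live in one universe ℓ, which plays the role of
-- the universe of sets.

Restrict : (S : Setoid ℓ ℓ) → Pred (Setoid.Carrier S) ℓ → Setoid ℓ ℓ
Restrict S P = On.setoid {B = ∃ P} S proj₁

_[_] : {S T : Setoid ℓ ℓ} → Func S T → Pred (Setoid.Carrier S) ℓ → Pred (Setoid.Carrier T) ℓ
_[_] {T = T} f X y = ∃[ x ] (x ∈ X × Func.to f x ≈ y)
  where open Setoid T using (_≈_)

record Multioperations (S : Setoid ℓ ℓ) : Set (suc ℓ) where
  open Setoid S using (Carrier; _≈_)
  field
    op          : Symbol n → Vector Carrier n → Pred Carrier ℓ
    op-nonempty : (c : Symbol n) (a : Vector Carrier n) → Satisfiable (op c a)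
    op-respʳ    : (c : Symbol n) (a : Vector Carrier n) → op c a Respects _≈_
    op-respˡ    : (c : Symbol n) {a b : Vector Carrier n} → Pointwise _≈_ a b → op c a ⊆ op c b

record Multialgebra (ℓ : Level) : Set (suc ℓ) where
  field
    setoid          : Setoid ℓ ℓ
    point           : Setoid.Carrier setoid
    multioperations : Multioperations setoid
  open Setoid setoid public
  open Multioperations multioperations public

record Submultialgebra (𝒜 : Multialgebra ℓ) : Set (suc ℓ) where
  private module A = Multialgebra 𝒜
  field
    dom             : Pred A.Carrier ℓ
    dom-resp        : dom Respects A._≈_
    point           : ∃ dom
    multioperations : Multioperations (Restrict A.setoid dom)
  open Multioperations multioperations public
  field
    op-⊆ : (c : Symbol n) (a : Vector (∃ dom) n) {u : ∃ dom} →
           u ∈ op c a → proj₁ u ∈ A.op c (proj₁ ∘ a)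

  multialgebra : Multialgebra ℓ
  multialgebra = record
    { setoid = Restrict A.setoid dom ; point = point ; multioperations = multioperations }

record Homomorphism (𝒜 ℬ : Multialgebra ℓ) : Set ℓ where
  private
    module A = Multialgebra 𝒜
    module B = Multialgebra ℬ
  field
    func : Func A.setoid B.setoid
  open Func func public using (to; cong)
  field
    image-⊆ : (c : Symbol n) (a : Vector A.Carrier n) → func [ A.op c a ] ⊆ B.op c (to ∘ a)

record _≅_ (𝒜 ℬ : Multialgebra ℓ) : Set ℓ where
  private
    module A = Multialgebra 𝒜
    module B = Multialgebra ℬ
  field
    func : Func A.setoid B.setoid
  open Func func public using (to; cong)
  field
    bijective : Bijective A._≈_ B._≈_ to
    image-≐   : (c : Symbol n) (a : Vector A.Carrier n) → func [ A.op c a ] ≐ B.op c (to ∘ a)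

Product : {I : Set ℓ} → (I → Multialgebra ℓ) → Multialgebra ℓ
Product {I = I} 𝒜 = record
  { setoid = record
    { Carrier       = ∀ i → A.Carrier i
    ; _≈_           = λ x y → ∀ i → A._≈_ i (x i) (y i)
    ; isEquivalence = record
      { refl  = λ i → A.refl i
      ; sym   = λ p i → A.sym i (p i)
      ; trans = λ p q i → A.trans i (p i) (q i)
      }
    }
  ; point = λ i → A.point i
  ; multioperations = record
    { op          = λ c a u → ∀ i → u i ∈ A.op i c (λ k → a k i)
    ; op-nonempty = λ c a → (λ i → proj₁ (A.op-nonempty i c (λ k → a k i)))
                          , (λ i → proj₂ (A.op-nonempty i c (λ k → a k i)))
    ; op-respʳ    = λ c a u≈v u∈ i → A.op-respʳ i c (λ k → a k i) (u≈v i) (u∈ i)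
    ; op-respˡ    = λ c a≈b u∈ i → A.op-respˡ i c (λ k → a≈b k i) (u∈ i)
    }
  }
  where module A i = Multialgebra (𝒜 i)

Image : {𝒜 ℬ : Multialgebra ℓ} → Homomorphism 𝒜 ℬ → Multialgebra ℓ
Image {ℓ} {𝒜} {ℬ} f = record
  { setoid = Restrict B.setoid f[A]
  ; point  = F.to A.point , A.point , B.refl
  ; multioperations = record
    { op          = λ c b u → ∃[ a ] (Pointwise B._≈_ (F.to ∘ a) (proj₁ ∘ b)
                                      × proj₁ u ∈ F.func [ A.op c a ])
    ; op-nonempty = λ c b →
        let a       = λ k → proj₁ (proj₂ (b k))
            x , x∈  = A.op-nonempty c a
        in (F.to x , x , B.refl) , a , (λ k → proj₂ (proj₂ (b k))) , x , x∈ , B.refl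
    ; op-respʳ    = λ { c b u≈v (a , fa≈b , x , x∈ , fx≈u) →
                        a , fa≈b , x , x∈ , B.trans fx≈u u≈v }
    ; op-respˡ    = λ { c b≈b′ (a , fa≈b , u∈) →
                        a , (λ k → B.trans (fa≈b k) (b≈b′ k)) , u∈ }
    }
  }
  where
  module A = Multialgebra 𝒜
  module B = Multialgebra ℬ
  module F = Homomorphism f

  f[A] : Pred B.Carrier ℓ
  f[A] y = ∃[ x ] (F.to x B.≈ y)

module _ (𝒜 : BooleanAlgebra ℓ ℓ) where
  open BooleanAlgebra 𝒜

  tripleSetoid : Setoid ℓ ℓ
  tripleSetoid = ×-setoid setoid (×-setoid setoid setoid)

  Triple : Set ℓ
  Triple = Setoid.Carrier tripleSetoid

  π₁ π₂ π₃ : Triple → Carrier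
  π₁ (z₁ , _ , _) = z₁
  π₂ (_ , z₂ , _) = z₂
  π₃ (_ , _ , z₃) = z₃

  Snapshot : Pred Triple ℓ
  Snapshot z = (π₁ z ∨ π₂ z) ≈ ⊤ × ((π₁ z ∧ π₂ z) ∧ π₃ z) ≈ ⊥

  -- The first coordinate required of every value of a multioperation.
  -- Boolean implication is x → y = ¬ x ∨ y.
  firstCoordinate : Symbol n → Vector Triple n → Carrier
  firstCoordinate and  z = π₁ (z 0F) ∧ π₁ (z 1F)
  firstCoordinate or   z = π₁ (z 0F) ∨ π₁ (z 1F)
  firstCoordinate imp  z = ¬ π₁ (z 0F) ∨ π₁ (z 1F)
  firstCoordinate neg  z = π₂ (z 0F)
  firstCoordinate circ z = π₃ (z 0F)

  record SwapStructure : Set (suc ℓ) where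
    field
      dom             : Pred Triple ℓ
      dom-resp        : dom Respects Setoid._≈_ tripleSetoid
      dom-⊆           : dom ⊆ Snapshot
      zero∈π₁         : ∃[ z ] (z ∈ dom × π₁ z ≈ ⊥)
      multioperations : Multioperations (Restrict tripleSetoid dom)
    open Multioperations multioperations public
    field
      op-first : (c : Symbol n) (z : Vector (∃ dom) n) {u : ∃ dom} →
                 u ∈ op c z → π₁ (proj₁ u) ≈ firstCoordinate c (proj₁ ∘ z)

    multialgebra : Multialgebra ℓ
    multialgebra = record
      { setoid          = Restrict tripleSetoid dom
      ; point           = proj₁ zero∈π₁ , proj₁ (proj₂ zero∈π₁)
      ; multioperations = multioperations
      }

-- A class of multialgebras is presented as a family; membership and all closure
-- properties are up to isomorphism.
record Class (ℓ : Level) : Set (suc (suc ℓ)) where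
  field
    Index  : Set (suc ℓ)
    member : Index → Multialgebra ℓ

_∈≅_ : Multialgebra ℓ → Class ℓ → Set (suc ℓ)
ℳ ∈≅ 𝕂 = ∃[ s ] (ℳ ≅ Class.member 𝕂 s)

ClosedUnderSubmultialgebras : Class ℓ → Set (suc ℓ)
ClosedUnderSubmultialgebras 𝕂 =
  ∀ s (ℬ : Submultialgebra (member s)) → Submultialgebra.multialgebra ℬ ∈≅ 𝕂
  where open Class 𝕂

ClosedUnderProducts : Class ℓ → Set (suc ℓ)
ClosedUnderProducts {ℓ} 𝕂 =
  ∀ (I : Set ℓ) (s : I → Index) → Product (λ i → member (s i)) ∈≅ 𝕂
  where open Class 𝕂

ClosedUnderHomomorphicImages : Class ℓ → Set (suc ℓ)
ClosedUnderHomomorphicImages {ℓ} 𝕂 =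
  ∀ s (ℬ : Multialgebra ℓ) (f : Homomorphism (member s) ℬ) → Image f ∈≅ 𝕂
  where open Class 𝕂

𝕂mbC : (ℓ : Level) → Class ℓ
𝕂mbC ℓ = record
  { Index  = Σ (BooleanAlgebra ℓ ℓ) SwapStructure
  ; member = λ (𝒜 , ℬ) → SwapStructure.multialgebra ℬ
  }

{-# OPTIONS --safe #-}
-- Submultialgebras.  Only 0 ∈ π₁[B] needs an argument: for any z ∈ B, every element of
-- (z ∧ ¬z) ∧ ∘z has first coordinate z₁ ∧ z₂ ∧ z₃ = 0.
--
-- Homomorphic images.  Over a Boolean algebra 𝒜, take all snapshots with the largest
-- multioperations.  Every triple (x, ¬x, y) is a snapshot, so prescribing the first
-- coordinate leaves the third one arbitrary, and the image under π₃ is A with all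
-- multioperations total.  In a swap structure with total multioperations, z ∈ z → z for
-- any z with z₁ = 0, hence 0 = z₁ = 1 and there is only one element.  So the image is not
-- a swap structure as soon as 0 ≠ 1 in 𝒜.
module Submission where

open import Level using (Level; _⊔_)
open import Algebra.Lattice.Bundles using (BooleanAlgebra)
import Algebra.Lattice.Properties.BooleanAlgebra as BooleanAlgebraProperties
open import Data.Bool.Properties using (∨-∧-booleanAlgebra)
open import Data.Fin.Patterns using (0F; 1F)
open import Data.Nat using (ℕ)
open import Data.Product using (∃; ∃-syntax; _×_; _,_; proj₁; proj₂)
open import Data.Unit.Polymorphic using (tt) renaming (⊤ to ⊤ₚ)
open import Data.Vec.Functional using (Vector; []; _∷_)
open import Data.Vec.Functional.Relation.Binary.Pointwise using (Pointwise)
open import Function using (_∘_; id; Inverse; Bijection)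
open import Function.Properties.Inverse using (Inverse⇒Bijection)
open import Relation.Binary using (Setoid)
import Relation.Binary.Reasoning.Setoid as ≈-Reasoning
open import Relation.Nullary using (¬_)
open import Relation.Unary using (Pred; _∈_)
open import Defs

private variable
  a ℓ : Level
  n : ℕ

-- Transport of multioperations along a bijection of setoids.

module _ {S T : Setoid ℓ ℓ} (S↔T : Inverse S T) where
  private module I = Inverse S↔T

  -- A swap structure must live on a predicate over triples, whereas submultialgebras and products
  -- arise on differently nested carriers; this moves their multioperations across the regrouping.
  transport : Multioperations S → Multioperations T
  transport M = record
    { op          = λ c b u → I.from u ∈ op c (I.from ∘ b)
    ; op-nonempty = λ c b → let x , x∈ = op-nonempty c (I.from ∘ b) in
        I.to x , op-respʳ c _ (S.sym (I.strictlyInverseʳ x)) x∈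
    ; op-respʳ    = λ c b u≈v → op-respʳ c _ (I.from-cong u≈v)
    ; op-respˡ    = λ c a≈b → op-respˡ c (I.from-cong ∘ a≈b)
    }
    where
    open Multioperations M
    module S = Setoid S

  -- The arguments `a k` and `I.from (I.to (a k))` agree only up to setoid equality, so both
  -- inclusions go through `op-respˡ`.
  transport-≅ : (x : Setoid.Carrier S) (y : Setoid.Carrier T) (M : Multioperations S) →
                record { setoid = S ; point = x ; multioperations = M } ≅
                record { setoid = T ; point = y ; multioperations = transport M }
  transport-≅ _ _ M = record
    { func      = record { to = I.to ; cong = I.to-cong }
    ; bijective = Bijection.bijective (Inverse⇒Bijection S↔T)
    ; image-≐   = λ c a →
        (λ (x , x∈ , to-x≈y) →
          op-respˡ c (λ k → S.sym (I.strictlyInverseʳ (a k)))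
            (op-respʳ c a (S.sym (I.inverseʳ (T.sym to-x≈y))) x∈))
      , (λ {y} y∈ →
          I.from y , op-respˡ c (λ k → I.strictlyInverseʳ (a k)) y∈ , I.strictlyInverseˡ y)
    }
    where
    open Multioperations M
    module S = Setoid S
    module T = Setoid T

-- Closure under submultialgebras.

module _ {𝒜 : BooleanAlgebra ℓ ℓ} (𝒮 : SwapStructure 𝒜)
         (ℬ : Submultialgebra (SwapStructure.multialgebra 𝒮)) where
  open BooleanAlgebra 𝒜
  private
    module S = SwapStructure 𝒮
    module B = Submultialgebra ℬ

    first : ∃ B.dom → Carrier
    first u = π₁ 𝒜 (proj₁ (proj₁ u))

    op-first : (c : Symbol n) (z : Vector (∃ B.dom) n) {u : ∃ B.dom} → u ∈ B.op c z →
               first u ≈ firstCoordinate 𝒜 c (λ k → proj₁ (proj₁ (z k)))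
    op-first c z u∈ = S.op-first c (proj₁ ∘ z) (B.op-⊆ c z u∈)

  zero∈π₁-sub : ∃[ u ] first u ≈ ⊥
  zero∈π₁-sub = w , (begin
    first w                              ≈⟨ op-first and (y ∷ v ∷ []) w∈ ⟩
    first y ∧ first v                    ≈⟨ ∧-congʳ (op-first and (z ∷ u ∷ []) y∈) ⟩
    (first z ∧ first u) ∧ first v        ≈⟨ ∧-cong (∧-congˡ (op-first neg (λ _ → z) u∈))
                                                   (op-first circ (λ _ → z) v∈) ⟩
    (first z ∧ π₂ 𝒜 z̲) ∧ π₃ 𝒜 z̲       ≈⟨ proj₂ (S.dom-⊆ (proj₂ (proj₁ z))) ⟩
    ⊥ ∎)
    where
    open ≈-Reasoning setoid
    -- All values are chosen by the nonemptiness of the operations of `ℬ` itself, so `w` stays in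
    -- the subdomain: `u` in ¬z, `v` in ∘z, `y` in z ∧ u, `w` in y ∧ v.
    z = B.point
    z̲ = proj₁ (proj₁ z)
    u = proj₁ (B.op-nonempty neg (λ _ → z))
    u∈ = proj₂ (B.op-nonempty neg (λ _ → z))
    v = proj₁ (B.op-nonempty circ (λ _ → z))
    v∈ = proj₂ (B.op-nonempty circ (λ _ → z))
    y = proj₁ (B.op-nonempty and (z ∷ u ∷ []))
    y∈ = proj₂ (B.op-nonempty and (z ∷ u ∷ []))
    w = proj₁ (B.op-nonempty and (y ∷ v ∷ []))
    w∈ = proj₂ (B.op-nonempty and (y ∷ v ∷ []))

  -- The choice of the membership proof `p` is immaterial: equality on the restricted setoid ignores
  -- it and `B.dom` respects that equality.
  subDom : Pred (Triple 𝒜) ℓ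
  subDom t = ∃[ p ] B.dom (t , p)

  subDom-↔ : Inverse (Restrict (Restrict (tripleSetoid 𝒜) S.dom) B.dom)
                     (Restrict (tripleSetoid 𝒜) subDom)
  subDom-↔ = record
    { to        = λ ((t , p) , q) → t , p , q
    ; from      = λ (t , p , q) → (t , p) , q
    ; to-cong   = id
    ; from-cong = id
    ; inverse   = id , id
    }

  subSwapStructure : SwapStructure 𝒜
  subSwapStructure = record
    { dom             = subDom
    ; dom-resp        = λ t≈t′ (p , q) → S.dom-resp t≈t′ p , B.dom-resp t≈t′ q
    ; dom-⊆           = λ (p , _) → S.dom-⊆ p
    ; zero∈π₁         = let ((t , p) , q) , t₁≈⊥ = zero∈π₁-sub in t , (p , q) , t₁≈⊥
    ; multioperations = transport subDom-↔ B.multioperations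
    ; op-first        = λ c z → op-first c (Inverse.from subDom-↔ ∘ z)
    }

closed-sub : ClosedUnderSubmultialgebras (𝕂mbC ℓ)
closed-sub (𝒜 , 𝒮) ℬ =
  (𝒜 , subSwapStructure 𝒮 ℬ) , transport-≅ (subDom-↔ 𝒮 ℬ) _ _ _

-- Closure under products.

ΠBooleanAlgebra : {I : Set ℓ} → (I → BooleanAlgebra a a) →
                  BooleanAlgebra (ℓ ⊔ a) (ℓ ⊔ a)
ΠBooleanAlgebra {I = I} 𝒜 = record
  { Carrier = ∀ i → A.Carrier i
  ; _≈_     = λ x y → ∀ i → A._≈_ i (x i) (y i)
  ; _∨_     = λ x y i → A._∨_ i (x i) (y i)
  ; _∧_     = λ x y i → A._∧_ i (x i) (y i)
  ; ¬_      = λ x i → A.¬_ i (x i)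
  ; ⊤       = λ i → A.⊤ i
  ; ⊥       = λ i → A.⊥ i
  ; isBooleanAlgebra = record
    { isDistributiveLattice = record
      { isLattice = record
        { isEquivalence = record
          { refl  = λ i → A.refl i
          ; sym   = λ p i → A.sym i (p i)
          ; trans = λ p q i → A.trans i (p i) (q i)
          }
        ; ∨-comm     = λ x y i → A.∨-comm i (x i) (y i)
        ; ∨-assoc    = λ x y z i → A.∨-assoc i (x i) (y i) (z i)
        ; ∨-cong     = λ p q i → A.∨-cong i (p i) (q i)
        ; ∧-comm     = λ x y i → A.∧-comm i (x i) (y i)
        ; ∧-assoc    = λ x y z i → A.∧-assoc i (x i) (y i) (z i)
        ; ∧-cong     = λ p q i → A.∧-cong i (p i) (q i)
        ; absorptive = (λ x y i → A.∨-absorbs-∧ i (x i) (y i))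
                     , (λ x y i → A.∧-absorbs-∨ i (x i) (y i))
        }
      ; ∨-distrib-∧ = (λ x y z i → A.∨-distribˡ-∧ i (x i) (y i) (z i))
                    , (λ x y z i → A.∨-distribʳ-∧ i (x i) (y i) (z i))
      ; ∧-distrib-∨ = (λ x y z i → A.∧-distribˡ-∨ i (x i) (y i) (z i))
                    , (λ x y z i → A.∧-distribʳ-∨ i (x i) (y i) (z i))
      }
    ; ∨-complement = (λ x i → A.∨-complementˡ i (x i)) , (λ x i → A.∨-complementʳ i (x i))
    ; ∧-complement = (λ x i → A.∧-complementˡ i (x i)) , (λ x i → A.∧-complementʳ i (x i))
    ; ¬-cong       = λ p i → A.¬-cong i (p i)
    }
  }
  where module A i = BooleanAlgebra (𝒜 i)

module _ {I : Set ℓ} (𝒜 : I → BooleanAlgebra ℓ ℓ) (𝒮 : ∀ i → SwapStructure (𝒜 i)) where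
  private
    module S i = SwapStructure (𝒮 i)

    Π𝒜 : BooleanAlgebra ℓ ℓ
    Π𝒜 = ΠBooleanAlgebra 𝒜

  component : Triple Π𝒜 → ∀ i → Triple (𝒜 i)
  component (x , y , z) i = x i , y i , z i

  -- The operations of the product algebra are componentwise by definition, but `firstCoordinate`
  -- computes only once the symbol is known; hence the case split with `id` throughout.
  firstCoordinate-Π : (c : Symbol n) (z : Vector (Triple Π𝒜) n) (x : BooleanAlgebra.Carrier Π𝒜) →
    (∀ i → BooleanAlgebra._≈_ (𝒜 i) (x i) (firstCoordinate (𝒜 i) c (λ k → component (z k) i))) →
    BooleanAlgebra._≈_ Π𝒜 x (firstCoordinate Π𝒜 c z)
  firstCoordinate-Π and  _ _ = id
  firstCoordinate-Π or   _ _ = id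
  firstCoordinate-Π imp  _ _ = id
  firstCoordinate-Π neg  _ _ = id
  firstCoordinate-Π circ _ _ = id

  ΠDom : Pred (Triple Π𝒜) ℓ
  ΠDom t = ∀ i → component t i ∈ S.dom i

  ΠDom-↔ : Inverse (Multialgebra.setoid (Product S.multialgebra)) (Restrict (tripleSetoid Π𝒜) ΠDom)
  ΠDom-↔ = record
    { to        = λ x → ( (λ i → π₁ (𝒜 i) (proj₁ (x i)))
                        , (λ i → π₂ (𝒜 i) (proj₁ (x i)))
                        , (λ i → π₃ (𝒜 i) (proj₁ (x i))) )
                      , (λ i → proj₂ (x i))
    ; from      = λ (t , t∈) i → component t i , t∈ i
    ; to-cong   = λ p → (λ i → proj₁ (p i)) , (λ i → proj₁ (proj₂ (p i))) , (λ i → proj₂ (proj₂ (p i)))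
    ; from-cong = λ (p , q , r) i → p i , q i , r i
    ; inverse   = (λ p → (λ i → proj₁ (p i)) , (λ i → proj₁ (proj₂ (p i))) , (λ i → proj₂ (proj₂ (p i))))
                , (λ (p , q , r) i → p i , q i , r i)
    }

  ΠSwapStructure : SwapStructure Π𝒜
  ΠSwapStructure = record
    { dom             = ΠDom
    ; dom-resp        = λ (p , q , r) t∈ i → S.dom-resp i (p i , q i , r i) (t∈ i)
    ; dom-⊆           = λ t∈ → (λ i → proj₁ (S.dom-⊆ i (t∈ i))) , (λ i → proj₂ (S.dom-⊆ i (t∈ i)))
    -- Each factor carries an explicit witness, so collecting them needs no choice principle.
    ; zero∈π₁         = let t , t∈ = Inverse.to ΠDom-↔ (λ i → proj₁ (S.zero∈π₁ i) , proj₁ (proj₂ (S.zero∈π₁ i)))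
                        in t , t∈ , λ i → proj₂ (proj₂ (S.zero∈π₁ i))
    ; multioperations = transport ΠDom-↔ (Multialgebra.multioperations (Product S.multialgebra))
    ; op-first        = λ c z {u} u∈ → firstCoordinate-Π c (proj₁ ∘ z) (π₁ Π𝒜 (proj₁ u))
                          (λ i → S.op-first i c (λ k → Inverse.from ΠDom-↔ (z k) i) (u∈ i))
    }

closed-product : ClosedUnderProducts (𝕂mbC ℓ)
closed-product I s =
  (_ , ΠSwapStructure 𝒜 𝒮) , transport-≅ (ΠDom-↔ 𝒜 𝒮) _ _ _
  where
  𝒜 = proj₁ ∘ s
  𝒮 = λ i → proj₂ (s i)

-- Failure of closure under homomorphic images.

Total : Multialgebra ℓ → Set ℓ
Total ℳ = ∀ {n} (c : Symbol n) a u → u ∈ op c a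
  where open Multialgebra ℳ

-- By surjectivity the arguments and the value all have preimages, and totality of `ℳ` relates
-- these.
total-≅ : {ℳ 𝒩 : Multialgebra ℓ} → ℳ ≅ 𝒩 → Total ℳ → Total 𝒩
total-≅ {ℳ = ℳ} {𝒩} ℳ≅𝒩 total c b u =
  N.op-respˡ c (λ k → to-from (b k))
    (proj₁ (F.image-≐ c (from ∘ b)) (from u , total c (from ∘ b) (from u) , to-from u))
  where
  module M = Multialgebra ℳ
  module N = Multialgebra 𝒩
  module F = _≅_ ℳ≅𝒩

  from : N.Carrier → M.Carrier
  from y = proj₁ (proj₂ F.bijective y)

  to-from : ∀ y → F.to (from y) N.≈ y
  to-from y = proj₂ (proj₂ F.bijective y) M.refl

total-swap⇒trivial : {𝒜 : BooleanAlgebra ℓ ℓ} (𝒮 : SwapStructure 𝒜) →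
  let open SwapStructure 𝒮 using (multialgebra) in
  Total multialgebra → ∀ u v → Multialgebra._≈_ multialgebra u v
total-swap⇒trivial {𝒜 = 𝒜} 𝒮 total u v = all-≈ , all-≈ , all-≈
  where
  open BooleanAlgebra 𝒜 renaming (¬_ to infix 8 ∁_)
  open BooleanAlgebraProperties 𝒜
  open SwapStructure 𝒮 using (zero∈π₁; op-first)
  open ≈-Reasoning setoid

  z₁≈⊥ = proj₂ (proj₂ zero∈π₁)
  z = proj₁ zero∈π₁ , proj₁ (proj₂ zero∈π₁)
  z₁ = π₁ 𝒜 (proj₁ z)

  ⊥≈⊤ : ⊥ ≈ ⊤
  ⊥≈⊤ = begin
    ⊥             ≈⟨ z₁≈⊥ ⟨
    z₁            ≈⟨ op-first imp (λ _ → z) (total imp (λ _ → z) z) ⟩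
    ∁ z₁ ∨ z₁     ≈⟨ ∨-complementˡ z₁ ⟩
    ⊤             ∎

  ≈-⊥ : ∀ x → x ≈ ⊥
  ≈-⊥ x = begin
    x      ≈⟨ ∧-identityʳ x ⟨
    x ∧ ⊤  ≈⟨ ∧-congˡ ⊥≈⊤ ⟨
    x ∧ ⊥  ≈⟨ ∧-zeroʳ x ⟩
    ⊥      ∎

  all-≈ : ∀ {x y} → x ≈ y
  all-≈ = trans (≈-⊥ _) (sym (≈-⊥ _))

module _ (𝒜 : BooleanAlgebra ℓ ℓ) where
  open BooleanAlgebra 𝒜 renaming (¬_ to infix 8 ∁_)
  open BooleanAlgebraProperties 𝒜

  snapshot : Carrier → Carrier → ∃ (Snapshot 𝒜)
  snapshot x y = (x , ∁ x , y) , ∨-complementʳ x , trans (∧-congʳ (∧-complementʳ x)) (∧-zeroˡ y)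

  firstCoordinate-cong : (c : Symbol n) {z w : Vector (Triple 𝒜) n} →
    Pointwise (Setoid._≈_ (tripleSetoid 𝒜)) z w → firstCoordinate 𝒜 c z ≈ firstCoordinate 𝒜 c w
  firstCoordinate-cong and  p = ∧-cong (proj₁ (p 0F)) (proj₁ (p 1F))
  firstCoordinate-cong or   p = ∨-cong (proj₁ (p 0F)) (proj₁ (p 1F))
  firstCoordinate-cong imp  p = ∨-cong (¬-cong (proj₁ (p 0F))) (proj₁ (p 1F))
  firstCoordinate-cong neg  p = proj₁ (proj₂ (p 0F))
  firstCoordinate-cong circ p = proj₂ (proj₂ (p 0F))

  fullSwapStructure : SwapStructure 𝒜
  fullSwapStructure = record
    { dom             = Snapshot 𝒜
    ; dom-resp        = λ (p , q , r) (z₁∨z₂≈⊤ , z₁∧z₂∧z₃≈⊥) →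
        trans (sym (∨-cong p q)) z₁∨z₂≈⊤ , trans (sym (∧-cong (∧-cong p q) r)) z₁∧z₂∧z₃≈⊥
    ; dom-⊆           = id
    ; zero∈π₁         = let t , t∈ = snapshot ⊥ ⊥ in t , t∈ , refl
    ; multioperations = record
      { op          = λ c z u → π₁ 𝒜 (proj₁ u) ≈ firstCoordinate 𝒜 c (proj₁ ∘ z)
      ; op-nonempty = λ c z → snapshot (firstCoordinate 𝒜 c (proj₁ ∘ z)) ⊥ , refl
      ; op-respʳ    = λ c z (p , _) → trans (sym p)
      ; op-respˡ    = λ c z≈w u₁≈ → trans u₁≈ (firstCoordinate-cong c z≈w)
      }
    ; op-first        = λ c z → id
    }

  -- Every setoid function into a total multialgebra is a homomorphism, so `π₃` qualifies as one.
  totalMultialgebra : Multialgebra ℓ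
  totalMultialgebra = record
    { setoid          = setoid
    ; point           = ⊥
    ; multioperations = record
      { op          = λ _ _ _ → ⊤ₚ
      ; op-nonempty = λ _ _ → ⊥ , tt
      ; op-respʳ    = λ _ _ _ → id
      ; op-respˡ    = λ _ _ → id
      }
    }

  π₃-homomorphism : Homomorphism (SwapStructure.multialgebra fullSwapStructure) totalMultialgebra
  π₃-homomorphism = record
    { func    = record { to = π₃ 𝒜 ∘ proj₁ ; cong = proj₂ ∘ proj₂ }
    ; image-⊆ = λ _ _ _ → tt
    }

  π₃-image-total : Total (Image π₃-homomorphism)
  π₃-image-total c b (y , _) =
    -- The preimages of the arguments come from their membership in the image. The `_` is the first
    -- coordinate that the operation prescribes on them, and `y` is the free third coordinate.
    (λ k → proj₁ (proj₂ (b k))) , (λ k → proj₂ (proj₂ (b k))) , snapshot _ y , refl , refl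

  closed-image⇒trivial : ClosedUnderHomomorphicImages (𝕂mbC ℓ) → ⊥ ≈ ⊤
  closed-image⇒trivial closed =
    let (_ , 𝒮) , image≅𝒮 = closed (𝒜 , fullSwapStructure) totalMultialgebra π₃-homomorphism
        module F = _≅_ image≅𝒮
        -- Two points of the image over `⊥` and `⊤`; triviality of `𝒮` identifies their values, and
        -- injectivity of the isomorphism then gives `⊥ ≈ ⊤`.
        a = ⊥ , snapshot ⊥ ⊥ , refl
        b = ⊤ , snapshot ⊥ ⊤ , refl
    in proj₁ F.bijective {a} {b}
         (total-swap⇒trivial 𝒮 (total-≅ image≅𝒮 π₃-image-total) (F.to a) (F.to b))

-- The power of the two-element algebra over a singleton moves it into universe ℓ.
𝟚 : (ℓ : Level) → BooleanAlgebra ℓ ℓ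
𝟚 ℓ = ΠBooleanAlgebra {I = ⊤ₚ {ℓ}} (λ _ → ∨-∧-booleanAlgebra)

not-closed-image : ¬ ClosedUnderHomomorphicImages (𝕂mbC ℓ)
-- Evaluated at the only index `tt`, the equation reads `false ≡ true`.
not-closed-image {ℓ} closed with () ← closed-image⇒trivial (𝟚 ℓ) closed tt

proposition7p8 : (ℓ : Level) → ClosedUnderSubmultialgebras (𝕂mbC ℓ) × ClosedUnderProducts (𝕂mbC ℓ) × (¬ ClosedUnderHomomorphicImages (𝕂mbC ℓ))
proposition7p8 ℓ = closed-sub , closed-product , not-closed-image
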